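{- There exists an infinite family $\mathcal{F}$ of $\beta$-acyclic CNF-formulas such that for every $F\in\mathcal{F}$ having $n$ variables, there is no structured DNNF of size less than $2^{\Omega(\sqrt{n})}$ computing $F$.
   Context: Convention: the family contains formulas with arbitrarily large numbers of variables, and the bound means that there is a constant $c>0$ such that for every $F\in\mathcal{F}$ with $n$ variables ($n$ sufficiently large), every structured DNNF computing $F$ has size at least $2^{c\sqrt{n}}$. CNF-formulas: a literal is a variable $x$ or a negated variable $\neg x$; a clause is a finite set of literals, tautological if it contains some variable both negated and unnegated. A CNF-formula is a finite set of non-tautological clauses, identified with the boolean function on its variables that it induces. $\mathrm{var}(C)$ is the set of variables of a clause $C$. Hypergraphs: a hypergraph $\mathcal{H}$ is a finite set of finite sets (edges), with vertex set $V(\mathcal{H})=\bigcup_{e\in\mathcal{H}}e$. $\mathcal{H}$ is $\beta$-acyclic if there is an order $(x_1,\dots,x_n)$ of $V(\mathcal{H})$ such that for all $i\le n$ and all $e,f\in\mathcal{H}$ with $x_i\in e\cap f$, either $e\setminus\{x_1,\dots,x_i\}\subseteq f$ or $f\setminus\{x_1,\dots,x_i\}\subseteq e$. A CNF-formula $F$ is $\beta$-acyclic if the hypergraph $\{\mathrm{var}(C)\mid C\in F\}$ is $\beta$-acyclic. Circuits: a boolean circuit on variables $X$ is in Negation Normal Form (NNF) if its inputs are labeled by literals on $X$ and its internal gates are $\wedge$-gates or $\vee$-gates; it has a distinguished output gate and computes the boolean function computed by that gate. $\mathrm{size}(D)$ is the number of gates of $D$. For a gate $v$, $D_v$ is the sub-circuit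 rooted at $v$ and $\mathrm{var}(D_v)$ the set of variables labeling its inputs. An $\wedge$-gate $v$ is decomposable if $\mathrm{var}(D_{v_1})\cap\mathrm{var}(D_{v_2})=\emptyset$ for all distinct inputs $v_1,v_2$ of $v$. A DNNF is an NNF circuit all of whose $\wedge$-gates are decomposable. A vtree $T$ on $X$ is a (rooted) binary tree whose leaves are in one-to-one correspondence with $X$. An $\wedge$-gate $v$ respects a vertex $t$ of $T$ if $v$ has exactly two inputs $v_1,v_2$ and $\mathrm{var}(D_{v_1})\subseteq X_{t_1}$, $\mathrm{var}(D_{v_2})\subseteq X_{t_2}$, where $t_1,t_2$ are the children of $t$ and $X_{t_i}$ is the set of variables at the leaves of the subtree rooted at $t_i$. A DNNF $D$ respects $T$ if every $\wedge$-gate of $D$ respects some vertex of $T$. $D$ is structured if it respects some vtree on $X$. -}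

module Defs where

open import Data.Bool using (Bool; true; false; not)
open import Data.Bool.ListAction using (any; all)
open import Data.Fin using (Fin; zero; suc)
import Data.Fin as Fin
open import Data.Fin.Subset using (Subset; ⁅_⁆; _∪_; _∩_; ⋃)
import Data.Fin.Subset as Sub
open import Data.Fin.Subset.Properties using (_⊆?_; nonempty?)
import Data.Integer as ℤ
open import Data.List using (List; []; _∷_; [_]; _++_; map)
open import Data.List.Membership.Propositional using (_∈_)
open import Data.List.Relation.Unary.All using (All)
open import Data.List.Relation.Unary.Unique.Propositional using (Unique)
open import Data.Nat using (ℕ; suc; _≤_; _^_; NonZero)
open import Data.Product using (∃; ∃₂; _×_; _,_)
open import Data.Rational.Unnormalised using (ℚᵘ; _/_)
import Data.Rational.Unnormalised as ℚᵘ
open import Data.Sum using (_⊎_)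
open import Data.Tree.Binary using (Tree; leaf; node)
import Data.Unit as Unit
open import Data.Vec using ([]; _∷_; lookup)
open import Function using (_⇔_)
open import Function.Definitions using (Injective)
open import Level using (0ℓ)
open import Relation.Binary.PropositionalEquality using (_≡_; _≢_)
open import Relation.Nullary using (¬_; does)
open import Relation.Unary using (Pred)
import Relation.Unary as U

private
  variable
    n s : ℕ

------------------------------------------------------------------------
-- CNF-formulas

Assignment : ℕ → Set
Assignment n = Fin n → Bool

data Literal (n : ℕ) : Set where
  pos neg : Fin n → Literal n

varOf : Literal n → Fin n
varOf (pos x) = x
varOf (neg x) = x

evalLiteral : Assignment n → Literal n → Bool
evalLiteral τ (pos x) = τ x
evalLiteral τ (neg x) = not (τ x)

-- Clauses, formulas and hypergraphs are finite sets given by a list of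
-- their elements; nothing below depends on order or repetitions.

Clause : ℕ → Set
Clause n = List (Literal n)

Tautological : Clause n → Set
Tautological C = ∃ λ x → pos x ∈ C × neg x ∈ C

var : Clause n → Subset n
var C = ⋃ (map (λ l → ⁅ varOf l ⁆) C)

-- A formula with exactly n variables, which are named by Fin n: by
-- `covers`, each of them occurs in some clause.

record CNF (n : ℕ) : Set where
  field
    clauses         : List (Clause n)
    nonTautological : All (λ C → ¬ Tautological C) clauses
    covers          : ∀ x → x Sub.∈ ⋃ (map var clauses)

evalCNF : CNF n → Assignment n → Bool
evalCNF F τ = all (any (evalLiteral τ)) (CNF.clauses F)

------------------------------------------------------------------------
-- β-acyclicity

Hypergraph : ℕ → Set
Hypergraph n = List (Subset n)

vertices : Hypergraph n → Subset n
vertices = ⋃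

-- e ∖ {x₀, …, xᵢ} ⊆ f
_∖⟨_upTo_⟩⊆_ : ∀ {k} → Subset n → (Fin k → Fin n) → Fin k → Subset n → Set
e ∖⟨ x upTo i ⟩⊆ f =
  ∀ {v} → v Sub.∈ e → ¬ (∃ λ j → j Fin.≤ i × x j ≡ v) → v Sub.∈ f

record IsβOrder (H : Hypergraph n) {k : ℕ} (x : Fin k → Fin n) : Set where
  field
    injective  : Injective _≡_ _≡_ x
    enumerates : ∀ v → v Sub.∈ vertices H ⇔ (∃ λ i → x i ≡ v)
    nested     : ∀ i {e f} → e ∈ H → f ∈ H → x i Sub.∈ e ∩ f →
                 (e ∖⟨ x upTo i ⟩⊆ f) ⊎ (f ∖⟨ x upTo i ⟩⊆ e)

βAcyclic : Hypergraph n → Set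
βAcyclic {n} H = ∃₂ λ k (x : Fin k → Fin n) → IsβOrder H x

hypergraph : CNF n → Hypergraph n
hypergraph F = map var (CNF.clauses F)

βAcyclicCNF : CNF n → Set
βAcyclicCNF F = βAcyclic (hypergraph F)

------------------------------------------------------------------------
-- NNF circuits

-- A gate whose inputs are taken from s previously built gates.  Fan-in
-- is unrestricted.  In particular ∨-gate ⊥ is the constant false; without
-- it, unsatisfiable functions would have no DNNF at all, and lower bounds
-- for them would be vacuous.

data Gate (n s : ℕ) : Set where
  input         : Literal n → Gate n s
  ∧-gate ∨-gate : Subset s → Gate n s

-- The s gates of a circuit in topological order.  Gates are indexed by
-- Fin s with the most recently added gate at index zero, so an index
-- i into gs becomes suc i in gs ▷ g.

infixl 5 _▷_

data Gates (n : ℕ) : ℕ → Set where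
  []  : Gates n 0
  _▷_ : Gates n s → Gate n s → Gates n (suc s)

record NNF (n : ℕ) : Set where
  field
    size   : ℕ
    gates  : Gates n size
    output : Fin size

-- The set of gates that evaluate to true.

mutual

  trueGates : Gates n s → Assignment n → Subset s
  trueGates []       τ = []
  trueGates (gs ▷ g) τ = evalGate g τ (trueGates gs τ) ∷ trueGates gs τ

  evalGate : Gate n s → Assignment n → Subset s → Bool
  evalGate (input l)  τ V = evalLiteral τ l
  evalGate (∧-gate I) τ V = does (I ⊆? V)
  evalGate (∨-gate I) τ V = does (nonempty? (I ∩ V))

evalNNF : NNF n → Assignment n → Bool
evalNNF D τ = lookup (trueGates gates τ) output
  where open NNF D

_Computes_ : NNF n → CNF n → Set
D Computes F = ∀ τ → evalNNF D τ ≡ evalCNF F τ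

-- varsAt gs v is the set var(D_v).

mutual

  varsAt : Gates n s → Fin s → Pred (Fin n) 0ℓ
  varsAt (gs ▷ g) zero    = varsGate gs g
  varsAt (gs ▷ g) (suc v) = varsAt gs v

  varsGate : Gates n s → Gate n s → Pred (Fin n) 0ℓ
  varsGate gs (input l)  x = varOf l ≡ x
  varsGate gs (∧-gate I) x = ∃ λ v → v Sub.∈ I × varsAt gs v x
  varsGate gs (∨-gate I) x = ∃ λ v → v Sub.∈ I × varsAt gs v x

-- Every ∧-gate satisfies P, where P receives the gates preceding the
-- ∧-gate together with its set of inputs.

Every∧ : (∀ {r} → Gates n r → Subset r → Set) → Gates n s → Set
Every∧ P []              = Unit.⊤
Every∧ P (gs ▷ input _)  = Every∧ P gs
Every∧ P (gs ▷ ∧-gate I) = Every∧ P gs × P gs I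
Every∧ P (gs ▷ ∨-gate _) = Every∧ P gs

Decomposable : Gates n s → Subset s → Set
Decomposable gs I = ∀ {v₁ v₂} → v₁ Sub.∈ I → v₂ Sub.∈ I → v₁ ≢ v₂ →
  U.Empty (varsAt gs v₁ U.∩ varsAt gs v₂)

IsDNNF : NNF n → Set
IsDNNF D = Every∧ Decomposable (NNF.gates D)

------------------------------------------------------------------------
-- Structuredness

VTree : ℕ → Set
VTree n = Tree Unit.⊤ (Fin n)

leaves : VTree n → List (Fin n)
leaves (leaf x)     = [ x ]
leaves (node l _ r) = leaves l ++ leaves r

IsVTree : VTree n → Set
IsVTree T = Unique (leaves T) × (∀ x → x ∈ leaves T)

-- The vertices of T, each given as the subtree rooted at it.

data _VertexOf_ {n : ℕ} (t : VTree n) : VTree n → Set where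
  root  : t VertexOf t
  left  : ∀ {l u r} → t VertexOf l → t VertexOf node l u r
  right : ∀ {l u r} → t VertexOf r → t VertexOf node l u r

data RespectsVertex (gs : Gates n s) (I : Subset s) : VTree n → Set where
  respects : ∀ {t₁ u t₂} v₁ v₂ → v₁ ≢ v₂ → I ≡ ⁅ v₁ ⁆ ∪ ⁅ v₂ ⁆ →
             varsAt gs v₁ U.⊆ (_∈ leaves t₁) →
             varsAt gs v₂ U.⊆ (_∈ leaves t₂) →
             RespectsVertex gs I (node t₁ u t₂)

Respects : NNF n → VTree n → Set
Respects D T =
  Every∧ (λ gs I → ∃ λ t → t VertexOf T × RespectsVertex gs I t) (NNF.gates D)

Structured : NNF n → Set
Structured D = ∃ λ T → IsVTree T × Respects D T

------------------------------------------------------------------------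
-- The lower bound

-- 2^(c √ n) ≤ m over the reals, for c ≥ 0.  By continuity this means
-- 2^(a / b) ≤ m, i.e. 2 ^ a ≤ m ^ b, for every rational a / b ≥ 0 with
-- a / b ≤ c √ n, i.e. (a / b)² ≤ c² n.

2^⟨_√_⟩≤_ : ℚᵘ → ℕ → ℕ → Set
2^⟨ c √ n ⟩≤ m = ∀ a b .{{_ : NonZero b}} →
  (ℤ.+ a / b) ℚᵘ.* (ℤ.+ a / b) ℚᵘ.≤ (c ℚᵘ.* c) ℚᵘ.* (ℤ.+ n / 1) →
  2 ^ a ≤ m ^ b

{-# OPTIONS --safe #-}

-- Let N = 9m and let u₁,…,u_N and w₁,…,w_N be the two sides of a complete
-- bipartite graph.  Every edge e = (i , j) becomes a path uᵢ – pₑ – zₑ – wⱼ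
-- whose steps are the clauses c e = {uᵢ, pₑ} ∪ {z_f : f ≥ e}, b e = {pₑ, zₑ, rₑ}
-- and d j = {wⱼ} ∪ {zₑ : e ends in j}, all literals being positive.  The
-- staircase of z's in the c's makes the formula β-acyclic: eliminate the
-- w's, r's, p's, u's and finally the z's in increasing order.
--
-- A vtree has a vertex below which there are between a third and two thirds of
-- the u's.  Whichever way it divides the w's, there are 3m disjoint edges whose
-- ends lie on opposite sides.  Each of their paths is cut at one of its three
-- steps, so m of them are cut at the same step.  Setting the other variables to
-- suitable constants leaves the function ⋀ₖ (xₖ ∨ yₖ) with xₖ and yₖ separated,
-- for which the 2^m assignments yₖ = ¬ xₖ form a fooling set.  In a structured
-- DNNF, assignments of a fooling set use distinct gates to cross the cut.
-- Since there are at most 289 m² variables, m ≥ √n / 17.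

module Submission where

open import Defs
open import Data.Bool using (Bool; true; false; not; if_then_else_)
import Data.Bool as Bool
open import Data.Bool.ListAction using (any)
open import Data.Bool.Properties using (T-≡; if-eta)
open import Data.Fin using (Fin; zero; suc; toℕ; _↑ˡ_; _↑ʳ_; finToFun; funToFin; combine)
import Data.Fin as Fin
import Data.Fin.Properties as Fin
open import Data.Fin.Subset using (Subset; inside; outside; ⁅_⁆; _∪_; _∩_; ∁; ⋃; ⊤; ∣_∣)
import Data.Fin.Subset as Sub
open import Data.Fin.Subset.Properties
  using ( _⊆?_; nonempty?; drop-there; x∈p∩q⁺; x∈p∩q⁻; x∈p∪q⁺; x∈p∪q⁻; x∈⁅x⁆
        ; x∈⁅y⁆⇒x≡y; x∈∁p⇒x∉p; ∣∁p∣≡n∸∣p∣; ∣⊤∣≡n; ∣⁅x⁆∣≡1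
        ; p⊆q⇒∣p∣≤∣q∣; Empty-unique; ∣⊥∣≡0; ∉⊥ )
open import Data.Integer using (+_)
import Data.Integer as ℤ
import Data.Integer.Properties as ℤ
open import Data.List using (List; []; _∷_; _++_; map; filter; allFin)
open import Data.List.Membership.DecPropositional using () renaming (_∈?_ to mem?)
open import Data.List.Membership.Propositional using (find; lose) renaming (_∈_ to _∈ˡ_)
open import Data.List.Membership.Propositional.Properties
  using (∈-++⁺ˡ; ∈-++⁺ʳ; ∈-++⁻; ∈-map⁺; ∈-map⁻; ∈-filter⁺; ∈-filter⁻; ∈-allFin)
import Data.List.Relation.Unary.All as All
import Data.List.Relation.Unary.All.Properties as All
open import Data.List.Relation.Unary.AllPairs using ([]; _∷_)
open import Data.List.Relation.Unary.Any using (here; there)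
import Data.List.Relation.Unary.Any.Properties as Any
open import Data.List.Relation.Unary.Unique.Propositional using (Unique)
open import Data.Nat
open import Data.Nat.Properties
open import Data.Nat.Solver using (module +-*-Solver)
open import Data.Product using (Σ-syntax; ∃; ∃-syntax; _×_; _,_; proj₁; proj₂)
open import Data.Rational.Unnormalised using (ℚᵘ; Positive; *≤*)
import Data.Rational.Unnormalised as ℚᵘ
open import Data.Sum using (_⊎_; inj₁; inj₂)
import Data.Sum as Sum
open import Data.Sum.Function.Propositional using (_⊎-↔_)
open import Data.Tree.Binary using (leaf; node)
open import Data.Vec using ([]; _∷_; tabulate; here; there)
open import Data.Vec.Properties using (lookup⇒[]=; []=⇒lookup; lookup∘tabulate)
open import Function using (_∘_; id; case_of_; _↔_; Inverse; Injection; Equivalence; mk⇔)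
open import Function.Construct.Composition using (_↔-∘_)
open import Function.Construct.Identity using (↔-id)
open import Function.Definitions using (Injective)
open import Function.Properties.Inverse using (↔⇒↣)
open import Level using (0ℓ)
open import Relation.Binary.PropositionalEquality
open import Relation.Nullary using (¬_; Dec; yes; no; does; contradiction)
open import Relation.Nullary.Decidable using (map′; dec-true; dec-false)
open import Relation.Unary using (Pred; _∈_; Decidable)

private
  variable
    m n q s : ℕ

-- Separating gates of structured circuits

does-true : ∀ {A : Set} (a? : Dec A) → does a? ≡ true → A
does-true (yes a) _ = a

module _ {gs : Gates n s} {τ : Assignment n} where

  head-true : ∀ {g} → zero Sub.∈ trueGates (gs ▷ g) τ → evalGate g τ (trueGates gs τ) ≡ true
  head-true {g} p with evalGate g τ (trueGates gs τ) | p
  ... | true | here = refl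

  true-head : ∀ {g} → evalGate g τ (trueGates gs τ) ≡ true → zero Sub.∈ trueGates (gs ▷ g) τ
  true-head eq rewrite eq = here

  ∧-true : ∀ {I} → zero Sub.∈ trueGates (gs ▷ ∧-gate I) τ → I Sub.⊆ trueGates gs τ
  ∧-true {I} = does-true (I ⊆? trueGates gs τ) ∘ head-true {∧-gate I}

  true-∧ : ∀ {I} → I Sub.⊆ trueGates gs τ → zero Sub.∈ trueGates (gs ▷ ∧-gate I) τ
  true-∧ {I} = λ sub → true-head {∧-gate I} (dec-true (I ⊆? trueGates gs τ) sub)

  ∨-true : ∀ {I} → zero Sub.∈ trueGates (gs ▷ ∨-gate I) τ →
           ∃ λ v → v Sub.∈ I × v Sub.∈ trueGates gs τ
  ∨-true {I} p with does-true (nonempty? (I ∩ trueGates gs τ)) (head-true {∨-gate I} p)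
  ... | v , q = v , x∈p∩q⁻ I (trueGates gs τ) q

  true-∨ : ∀ {I v} → v Sub.∈ I → v Sub.∈ trueGates gs τ →
           zero Sub.∈ trueGates (gs ▷ ∨-gate I) τ
  true-∨ {I} {v} v∈I v∈V = true-head {∨-gate I}
    (dec-true (nonempty? (I ∩ trueGates gs τ)) (v , x∈p∩q⁺ (v∈I , v∈V)))

transfer : ∀ (gs : Gates n s) v {σ τ} → (∀ {x} → varsAt gs v x → σ x ≡ τ x) →
           v Sub.∈ trueGates gs σ → v Sub.∈ trueGates gs τ
transfer (gs ▷ g) (suc v) σ≗τ p = there (transfer gs v σ≗τ (drop-there p))
transfer (gs ▷ input (pos x)) zero σ≗τ p =
  true-head {gs = gs} {g = input (pos x)}
    (trans (sym (σ≗τ refl)) (head-true {gs = gs} {g = input (pos x)} p))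
transfer (gs ▷ input (neg x)) zero σ≗τ p =
  true-head {gs = gs} {g = input (neg x)}
    (trans (cong not (sym (σ≗τ refl))) (head-true {gs = gs} {g = input (neg x)} p))
transfer (gs ▷ ∧-gate I) zero σ≗τ p = true-∧ λ {v} v∈I →
  transfer gs v (λ q → σ≗τ (v , v∈I , q)) (∧-true p v∈I)
transfer (gs ▷ ∨-gate I) zero σ≗τ p with ∨-true p
... | v , v∈I , q = true-∨ v∈I (transfer gs v (λ r → σ≗τ (v , v∈I , r)) q)

module _ (A : Fin n → Bool) where

  mix : Assignment n → Assignment n → Assignment n
  mix τ τ′ x = if A x then τ x else τ′ x

  mix-inside : ∀ τ τ′ {x} → A x ≡ true → mix τ τ′ x ≡ τ x
  mix-inside τ τ′ eq rewrite eq = refl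

  mix-outside : ∀ τ τ′ {x} → A x ≡ false → mix τ τ′ x ≡ τ′ x
  mix-outside τ τ′ eq rewrite eq = refl

  mix-literal : ∀ {τ τ′} l → evalLiteral τ l ≡ true → evalLiteral τ′ l ≡ true →
                evalLiteral (mix τ τ′) l ≡ true
  mix-literal (pos x) p q with A x
  ... | true  = p
  ... | false = q
  mix-literal (neg x) p q with A x
  ... | true  = p
  ... | false = q

  Inside Outside : VTree n → Set
  Inside  t = ∀ {x} → x ∈ˡ leaves t → A x ≡ true
  Outside t = ∀ {x} → x ∈ˡ leaves t → A x ≡ false

  -- These are the cases that an ∧-gate needs: if one child of its vertex avoids `A`, only the other
  -- child has to be traced further.
  Laminar : VTree n → Set
  Laminar T = ∀ {l u r} → node l u r VertexOf T →
              (Inside l × Inside r) ⊎ Outside l ⊎ Outside r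

  Every∧-tail : ∀ {P : ∀ {r} → Gates n r → Subset r → Set} (gs : Gates n s) g →
                Every∧ P (gs ▷ g) → Every∧ P gs
  Every∧-tail gs (input _)  e = e
  Every∧-tail gs (∧-gate _) e = proj₁ e
  Every∧-tail gs (∨-gate _) e = e

  -- A certificate for cut-and-paste: every `τ` that shares the gate `g` may replace `τ′` inside `A`
  -- while `v` stays true.
  Separator : Gates n s → Assignment n → Fin s → Set
  Separator gs τ′ v = ∃ λ g → g Sub.∈ trueGates gs τ′ ×
    (∀ τ → g Sub.∈ trueGates gs τ → v Sub.∈ trueGates gs (mix τ τ′))

  -- Follow a run of τ′ from v down to the first gate g with all variables
  -- inside A.  What is left behind outside of A does not depend on τ, so g
  -- alone records what the run requires inside of A.
  separator : ∀ {T} → Laminar T → (gs : Gates n s) →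
    Every∧ (λ gs I → ∃ λ t → t VertexOf T × RespectsVertex gs I t) gs →
    ∀ {τ′} v → v Sub.∈ trueGates gs τ′ → Separator gs τ′ v
  separator lam (gs ▷ g) ev (suc v) p
    with separator lam gs (Every∧-tail gs g ev) v (drop-there p)
  ... | h , h-true , h-sep = suc h , there h-true , λ τ → there ∘ h-sep τ ∘ drop-there
  -- An input is its own separator even outside `A`: the mixture reads its variable from `τ` or
  -- `τ′`, and both make the literal true.
  separator lam (gs ▷ input l) ev zero p =
    zero , p , λ τ q → true-head {gs = gs} {g = input l}
      (mix-literal l (head-true {gs = gs} {g = input l} q) (head-true {gs = gs} {g = input l} p))
  separator lam (gs ▷ ∨-gate I) ev zero p with ∨-true p
  ... | v , v∈I , q with separator lam gs ev v q
  ...   | h , h-true , h-sep = suc h , there h-true , λ τ → true-∨ v∈I ∘ h-sep τ ∘ drop-there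
  separator lam (gs ▷ ∧-gate _) (ev , _ , t∈T , respects {t₁} {_} {t₂} v₁ v₂ _ refl ⊆t₁ ⊆t₂)
    {τ′} zero p =
    cases (lam t∈T)
    where
    child : ∀ {v} → v Sub.∈ ⁅ v₁ ⁆ ∪ ⁅ v₂ ⁆ → v ≡ v₁ ⊎ v ≡ v₂
    child = Sum.map (x∈⁅y⁆⇒x≡y v₁) (x∈⁅y⁆⇒x≡y v₂) ∘ x∈p∪q⁻ ⁅ v₁ ⁆ ⁅ v₂ ⁆

    v₁-true : v₁ Sub.∈ trueGates gs τ′
    v₁-true = ∧-true p (x∈p∪q⁺ {p = ⁅ v₁ ⁆} (inj₁ (x∈⁅x⁆ v₁)))

    v₂-true : v₂ Sub.∈ trueGates gs τ′
    v₂-true = ∧-true p (x∈p∪q⁺ {p = ⁅ v₁ ⁆} (inj₂ (x∈⁅x⁆ v₂)))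

    both : ∀ {σ} → v₁ Sub.∈ trueGates gs σ → v₂ Sub.∈ trueGates gs σ →
           zero Sub.∈ trueGates (gs ▷ ∧-gate (⁅ v₁ ⁆ ∪ ⁅ v₂ ⁆)) σ
    both q₁ q₂ = true-∧ λ v∈I → case child v∈I of λ where
      (inj₁ refl) → q₁
      (inj₂ refl) → q₂

    cases : (Inside t₁ × Inside t₂) ⊎ Outside t₁ ⊎ Outside t₂ →
            Separator (gs ▷ ∧-gate (⁅ v₁ ⁆ ∪ ⁅ v₂ ⁆)) τ′ zero
    -- Below this gate the mixture coincides with `τ`, so the gate is its own separator.
    cases (inj₁ (in₁ , in₂)) = zero , p , λ τ →
      transfer (gs ▷ ∧-gate (⁅ v₁ ⁆ ∪ ⁅ v₂ ⁆)) zero λ (v , v∈I , q) →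
        sym (mix-inside τ τ′ (case child v∈I of λ where
          (inj₁ refl) → in₁ (⊆t₁ q)
          (inj₂ refl) → in₂ (⊆t₂ q)))
    -- The child outside `A` keeps the values of `τ′` and stays true; the search continues in the
    -- other child.
    cases (inj₂ (inj₁ out)) with separator lam gs ev v₂ v₂-true
    ... | h , h-true , h-sep = suc h , there h-true , λ τ q → both
      (transfer gs v₁ (λ r → sym (mix-outside τ τ′ (out (⊆t₁ r)))) v₁-true)
      (h-sep τ (drop-there q))
    cases (inj₂ (inj₂ out)) with separator lam gs ev v₁ v₁-true
    ... | h , h-true , h-sep = suc h , there h-true , λ τ q → both
      (h-sep τ (drop-there q))
      (transfer gs v₂ (λ r → sym (mix-outside τ τ′ (out (⊆t₂ r)))) v₂-true)

-- Laminarity of the leaf sets of a vtree.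

vertex⇒leaves⊆ : ∀ {t T : VTree n} → t VertexOf T → ∀ {x} → x ∈ˡ leaves t → x ∈ˡ leaves T
vertex⇒leaves⊆ root q = q
vertex⇒leaves⊆ (left v) q = ∈-++⁺ˡ (vertex⇒leaves⊆ v q)
vertex⇒leaves⊆ (right {l} v) q = ∈-++⁺ʳ (leaves l) (vertex⇒leaves⊆ v q)

unique-++⁻ : ∀ {A : Set} (xs {ys} : List A) → Unique (xs ++ ys) →
             Unique xs × Unique ys × (∀ {x} → x ∈ˡ xs → ¬ x ∈ˡ ys)
unique-++⁻ [] u = [] , u , λ ()
unique-++⁻ (x ∷ xs) (x∉ ∷ u) with unique-++⁻ xs u
... | uˣ , uʸ , disj = All.++⁻ˡ xs x∉ ∷ uˣ , uʸ , λ where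
  (here refl) q → All.lookup (All.++⁻ʳ xs x∉) q refl
  (there p)   q → disj p q

below : VTree n → Fin n → Bool
below t x = does (mem? Fin._≟_ x (leaves t))

below-true : ∀ (t : VTree n) {x} → x ∈ˡ leaves t → below t x ≡ true
below-true t = dec-true (mem? Fin._≟_ _ (leaves t))

below-false : ∀ (t : VTree n) {x} → ¬ x ∈ˡ leaves t → below t x ≡ false
below-false t = dec-false (mem? Fin._≟_ _ (leaves t))

-- A vertex lies in the subtree of `t`, strictly above `t`, or apart from it. As leaves are unique,
-- in the second case the child not leading to `t` is outside, and in the third case both children
-- are.
laminar-below : ∀ {t T : VTree n} → Unique (leaves T) → t VertexOf T → Laminar (below t) T
laminar-below {t = t} {T} U root v = inj₁
  ( (λ q → below-true T (vertex⇒leaves⊆ v (∈-++⁺ˡ q)))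
  , (λ q → below-true T (vertex⇒leaves⊆ v (∈-++⁺ʳ _ q))) )
laminar-below {t = t} {T = node L _ R} U (left w) v with unique-++⁻ (leaves L) U | v
... | U₁ , _ , disj | root    = inj₂ (inj₂ λ q → below-false t λ q′ → disj (vertex⇒leaves⊆ w q′) q)
... | U₁ , _ , disj | left v′ = laminar-below U₁ w v′
... | U₁ , _ , disj | right v′ = inj₂ (inj₁ λ q → below-false t λ q′ →
  disj (vertex⇒leaves⊆ w q′) (vertex⇒leaves⊆ v′ (∈-++⁺ˡ q)))
laminar-below {t = t} {T = node L _ R} U (right w) v with unique-++⁻ (leaves L) U | v
... | _ , U₂ , disj | root    = inj₂ (inj₁ λ q → below-false t λ q′ → disj q (vertex⇒leaves⊆ w q′))
... | _ , U₂ , disj | right v′ = laminar-below U₂ w v′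
... | _ , U₂ , disj | left v′ = inj₂ (inj₁ λ q → below-false t λ q′ →
  disj (vertex⇒leaves⊆ v′ (∈-++⁺ˡ q)) (vertex⇒leaves⊆ w q′))

-- Selecting elements, and balanced vertices of vtrees

-- Injections rather than subsets, so that successive selections compose and `Fin s` can index the
-- bits of a fooling set.
Selection : ℕ → (Fin n → Set) → Set
Selection {n} s P = ∃ λ (f : Fin s → Fin n) → Injective _≡_ _≡_ f × ∀ k → P (f k)

select : ∀ s (p : Subset n) → s ≤ ∣ p ∣ → Selection s (Sub._∈ p)
select zero    p             _         = (λ ()) , (λ { {()} }) , λ ()
select (suc s) (outside ∷ p) s≤        with select (suc s) p s≤
... | f , f-inj , f∈p = suc ∘ f , f-inj ∘ Fin.suc-injective , there ∘ f∈p
select (suc s) (inside ∷ p)  (s≤s s≤)  with select s p s≤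
... | f , f-inj , f∈p = g , g-inj , λ { zero → here ; (suc k) → there (f∈p k) }
  where
  g : Fin (suc s) → Fin _
  g zero    = zero
  g (suc k) = suc (f k)

  g-inj : Injective _≡_ _≡_ g
  g-inj {zero}  {zero}  _  = refl
  g-inj {suc _} {suc _} eq = cong suc (f-inj (Fin.suc-injective eq))

∣p∪q∣≤∣p∣+∣q∣ : (p q : Subset n) → ∣ p ∪ q ∣ ≤ ∣ p ∣ + ∣ q ∣
∣p∪q∣≤∣p∣+∣q∣ []            []            = z≤n
∣p∪q∣≤∣p∣+∣q∣ (outside ∷ p) (outside ∷ q) = ∣p∪q∣≤∣p∣+∣q∣ p q
∣p∪q∣≤∣p∣+∣q∣ (outside ∷ p) (inside ∷ q)  =
  ≤-trans (s≤s (∣p∪q∣≤∣p∣+∣q∣ p q)) (≤-reflexive (sym (+-suc ∣ p ∣ ∣ q ∣)))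
∣p∪q∣≤∣p∣+∣q∣ (inside ∷ p)  (outside ∷ q) = s≤s (∣p∪q∣≤∣p∣+∣q∣ p q)
∣p∪q∣≤∣p∣+∣q∣ (inside ∷ p)  (inside ∷ q)  =
  s≤s (≤-trans (∣p∪q∣≤∣p∣+∣q∣ p q) (+-monoʳ-≤ ∣ p ∣ (n≤1+n ∣ q ∣)))

∈-tabulate⁺ : ∀ {h : Fin n → Bool} {i} → h i ≡ true → i Sub.∈ tabulate h
∈-tabulate⁺ {h = h} {i} eq = lookup⇒[]= i _ (trans (lookup∘tabulate h i) eq)

∈-tabulate⁻ : ∀ {h : Fin n → Bool} {i} → i Sub.∈ tabulate h → h i ≡ true
∈-tabulate⁻ {h = h} {i} i∈ = trans (sym (lookup∘tabulate h i)) ([]=⇒lookup i∈)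

select-false : ∀ s (h : Fin n → Bool) → ∣ tabulate h ∣ + s ≤ n → Selection s (λ i → h i ≡ false)
select-false {n} s h le with select s (∁ (tabulate h)) s≤
  where
  s≤ : s ≤ ∣ ∁ (tabulate h) ∣
  s≤ = begin
    s                                             ≡⟨ sym (m+n∸m≡n ∣ tabulate h ∣ s) ⟩
    ∣ tabulate h ∣ + s ∸ ∣ tabulate h ∣           ≤⟨ ∸-monoˡ-≤ ∣ tabulate h ∣ le ⟩
    n ∸ ∣ tabulate h ∣                            ≡⟨ sym (∣∁p∣≡n∸∣p∣ (tabulate h)) ⟩
    ∣ ∁ (tabulate h) ∣                            ∎
    where open ≤-Reasoning
... | f , f-inj , f∉ = f , f-inj , λ k → ¬true (x∈∁p⇒x∉p (f∉ k))
  where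
  ¬true : ∀ {i} → ¬ i Sub.∈ tabulate h → h i ≡ false
  ¬true {i} i∉ with h i in eq
  ... | false = refl
  ... | true  = contradiction (∈-tabulate⁺ eq) i∉

-- Pigeonhole: when no more than `a` indices satisfy `P`, at least `b` of the `n` are left over.
split : ∀ a b {P : Fin n → Set} (P? : Decidable P) → a + b ≤ n →
        Selection a P ⊎ Selection b (λ i → ¬ P i)
split a b P? le with ≤-total a ∣ tabulate (does ∘ P?) ∣
... | inj₁ a≤ with select a (tabulate (does ∘ P?)) a≤
...   | f , f-inj , f∈ = inj₁ (f , f-inj , does-true (P? _) ∘ ∈-tabulate⁻ ∘ f∈)
split a b P? le | inj₂ ≤a with select-false b (does ∘ P?) (≤-trans (+-monoˡ-≤ b ≤a) le)
...   | f , f-inj , f∉ = inj₂ (f , f-inj , λ k Pfk →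
        contradiction (trans (sym (dec-true (P? (f k)) Pfk)) (f∉ k)) λ ())

below-true⁻ : ∀ (t : VTree n) {x} → below t x ≡ true → x ∈ˡ leaves t
below-true⁻ t {x} = does-true (mem? Fin._≟_ x (leaves t))

module _ {N} (x : Fin N → Fin n) where

  marked : VTree n → Subset N
  marked t = tabulate (below t ∘ x)

  marked⁻ : ∀ t {i} → i Sub.∈ marked t → x i ∈ˡ leaves t
  marked⁻ t = below-true⁻ t ∘ ∈-tabulate⁻

  marked⁺ : ∀ t {i} → x i ∈ˡ leaves t → i Sub.∈ marked t
  marked⁺ t = ∈-tabulate⁺ ∘ below-true t

  ∣marked-leaf∣≤1 : Injective _≡_ _≡_ x → ∀ v → ∣ marked (leaf v) ∣ ≤ 1
  ∣marked-leaf∣≤1 x-inj v with nonempty? (marked (leaf v))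
  ... | no empty rewrite Empty-unique empty | ∣⊥∣≡0 N = z≤n
  ... | yes (i , i∈) = ≤-trans (p⊆q⇒∣p∣≤∣q∣ sub) (≤-reflexive (∣⁅x⁆∣≡1 i))
    where
    leaf-label : ∀ {y v : Fin n} → y ∈ˡ (v ∷ []) → y ≡ v
    leaf-label (here eq) = eq

    sub : marked (leaf v) Sub.⊆ ⁅ i ⁆
    sub j∈ = subst (λ j → j Sub.∈ ⁅ i ⁆)
      (x-inj (trans (leaf-label (marked⁻ (leaf v) i∈)) (sym (leaf-label (marked⁻ (leaf v) j∈)))))
      (x∈⁅x⁆ i)

  ∣marked-node∣≤ : ∀ l u r → ∣ marked (node l u r) ∣ ≤ ∣ marked l ∣ + ∣ marked r ∣
  ∣marked-node∣≤ l u r = ≤-trans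
    (p⊆q⇒∣p∣≤∣q∣ λ i∈ → x∈p∪q⁺ {p = marked l}
      (Sum.map (marked⁺ l) (marked⁺ r) (∈-++⁻ (leaves l) (marked⁻ (node l u r) i∈))))
    (∣p∪q∣≤∣p∣+∣q∣ (marked l) (marked r))

  -- Descend into a child with at least `s` marks while the current node has more than `s + s`. Such
  -- a child exists, since two children with fewer than `s` marks would give at most `s + s`; a leaf
  -- has at most one.
  balanced : Injective _≡_ _≡_ x → 1 ≤ s → ∀ T → s ≤ ∣ marked T ∣ →
             ∃ λ t → t VertexOf T × s ≤ ∣ marked t ∣ × ∣ marked t ∣ ≤ s + s
  balanced {s} x-inj 1≤s (leaf v) s≤ =
    leaf v , root , s≤ , ≤-trans (∣marked-leaf∣≤1 x-inj v) (≤-trans 1≤s (m≤m+n s s))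
  balanced {s} x-inj 1≤s T@(node l u r) s≤ with ∣ marked T ∣ ≤? s + s
  ... | yes ≤2s = T , root , s≤ , ≤2s
  ... | no ≰2s with s ≤? ∣ marked l ∣ | s ≤? ∣ marked r ∣
  ...   | yes s≤l | _ with balanced x-inj 1≤s l s≤l
  ...     | t , t∈l , bounds = t , left t∈l , bounds
  balanced {s} x-inj 1≤s T@(node l u r) s≤ | no ≰2s | no _ | yes s≤r with balanced x-inj 1≤s r s≤r
  ...     | t , t∈r , bounds = t , right t∈r , bounds
  balanced {s} x-inj 1≤s T@(node l u r) s≤ | no ≰2s | no s≰l | no s≰r = contradiction
    (≤-trans (∣marked-node∣≤ l u r) (+-mono-≤ (≰⇒≥ s≰l) (≰⇒≥ s≰r))) ≰2s

-- Membership in unions, and evaluation of CNF-formulas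

∈-⋃⁺ : ∀ {ps : List (Subset n)} {p x} → p ∈ˡ ps → x Sub.∈ p → x Sub.∈ ⋃ ps
∈-⋃⁺ {ps = p ∷ ps} (here refl) x∈p = x∈p∪q⁺ (inj₁ x∈p)
∈-⋃⁺ {ps = p ∷ ps} (there q)   x∈p = x∈p∪q⁺ {p = p} (inj₂ (∈-⋃⁺ q x∈p))

∈-⋃⁻ : ∀ (ps : List (Subset n)) {x} → x Sub.∈ ⋃ ps → ∃ λ p → p ∈ˡ ps × x Sub.∈ p
∈-⋃⁻ []       x∈ = contradiction x∈ ∉⊥
∈-⋃⁻ (p ∷ ps) x∈ with x∈p∪q⁻ p (⋃ ps) x∈
... | inj₁ x∈p = p , here refl , x∈p
... | inj₂ x∈⋃ with ∈-⋃⁻ ps x∈⋃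
...   | q , q∈ , x∈q = q , there q∈ , x∈q

∈-var⁺ : ∀ {C : Clause n} {l} → l ∈ˡ C → varOf l Sub.∈ var C
∈-var⁺ l∈C = ∈-⋃⁺ (∈-map⁺ _ l∈C) (x∈⁅x⁆ _)

∈-var⁻ : ∀ {C : Clause n} {x} → x Sub.∈ var C → ∃ λ l → l ∈ˡ C × x ≡ varOf l
∈-var⁻ {C = C} x∈ with ∈-⋃⁻ (map (λ l → ⁅ varOf l ⁆) C) x∈
... | _ , q , x∈p with ∈-map⁻ (λ l → ⁅ varOf l ⁆) q
...   | l , l∈C , refl = l , l∈C , x∈⁅y⁆⇒x≡y _ x∈p

evalCNF⁺ : ∀ (F : CNF n) {τ} →
  (∀ {C} → C ∈ˡ CNF.clauses F → ∃ λ l → l ∈ˡ C × evalLiteral τ l ≡ true) → evalCNF F τ ≡ true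
evalCNF⁺ F {τ} sat = Equivalence.to T-≡ (All.all⁻ _ (All.tabulate λ C∈F →
  let l , l∈C , eq = sat C∈F in Any.any⁺ _ (lose l∈C (Equivalence.from T-≡ eq))))

evalCNF⁻ : ∀ (F : CNF n) {τ} → evalCNF F τ ≡ true →
  ∀ {C} → C ∈ˡ CNF.clauses F → ∃ λ l → l ∈ˡ C × evalLiteral τ l ≡ true
evalCNF⁻ F {τ} eq {C} C∈F
  with find (Any.any⁻ (evalLiteral τ) C (All.lookup
    (All.all⁺ (any (evalLiteral τ)) (CNF.clauses F) (Equivalence.from T-≡ eq)) C∈F))
... | l , l∈C , t = l , l∈C , Equivalence.to T-≡ t

-- The formula

module Formula (N : ℕ) where

  E : ℕ
  E = N * N

  row col : Fin E → Fin N
  row = Fin.quotient N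
  col = Fin.remainder {N} N

  edge : Fin N → Fin N → Fin E
  edge = combine

  row-edge : ∀ i j → row (edge i j) ≡ i
  row-edge i j = cong proj₁ (Fin.remQuot-combine i j)

  col-edge : ∀ i j → col (edge i j) ≡ j
  col-edge i j = cong proj₂ (Fin.remQuot-combine i j)

  -- The summands are listed in the order of elimination.
  Var : Set
  Var = Fin N ⊎ (Fin E ⊎ (Fin E ⊎ (Fin N ⊎ Fin E)))

  pattern w j = inj₁ j
  pattern r e = inj₂ (inj₁ e)
  pattern p e = inj₂ (inj₂ (inj₁ e))
  pattern u i = inj₂ (inj₂ (inj₂ (inj₁ i)))
  pattern z e = inj₂ (inj₂ (inj₂ (inj₂ e)))

  #vars : ℕ
  #vars = N + (E + (E + (N + E)))

  -- Nesting `Fin.+↔⊎` makes the summands consecutive blocks, so that `enc` computes to `↑ˡ` and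
  -- `↑ʳ` in the order comparisons below.
  numbering : Fin #vars ↔ Var
  numbering =
    (↔-id _ ⊎-↔ ((↔-id _ ⊎-↔ ((↔-id _ ⊎-↔ Fin.+↔⊎) ↔-∘ Fin.+↔⊎)) ↔-∘ Fin.+↔⊎)) ↔-∘ Fin.+↔⊎

  enc : Var → Fin #vars
  enc = Inverse.from numbering

  dec : Fin #vars → Var
  dec = Inverse.to numbering

  dec-enc : ∀ v → dec (enc v) ≡ v
  dec-enc = Inverse.strictlyInverseˡ numbering

  enc-dec : ∀ x → enc (dec x) ≡ x
  enc-dec = Inverse.strictlyInverseʳ numbering

  enc-injective : Injective _≡_ _≡_ enc
  enc-injective {a} {b} eq = trans (sym (dec-enc a)) (trans (cong dec eq) (dec-enc b))

  private
    ↑ˡ≤↑ʳ : ∀ {a b} (i : Fin a) (j : Fin b) → i ↑ˡ b Fin.≤ a ↑ʳ j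
    ↑ˡ≤↑ʳ {a} {b} i j rewrite Fin.toℕ-↑ˡ i b | Fin.toℕ-↑ʳ a j =
      ≤-trans (<⇒≤ (Fin.toℕ<n i)) (m≤m+n a (toℕ j))

    ↑ʳ-mono : ∀ a {b} {i j : Fin b} → i Fin.≤ j → a ↑ʳ i Fin.≤ a ↑ʳ j
    ↑ʳ-mono a {i = i} {j} le rewrite Fin.toℕ-↑ʳ a i | Fin.toℕ-↑ʳ a j = +-monoʳ-≤ a le

  r≤p : ∀ e f → enc (r e) Fin.≤ enc (p f)
  r≤p e f = ↑ʳ-mono N (↑ˡ≤↑ʳ e _)

  p≤u : ∀ e i → enc (p e) Fin.≤ enc (u i)
  p≤u e i = ↑ʳ-mono N (↑ʳ-mono E (↑ˡ≤↑ʳ e _))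

  z≤z : ∀ {e f} → e Fin.≤ f → enc (z e) Fin.≤ enc (z f)
  z≤z le = ↑ʳ-mono N (↑ʳ-mono E (↑ʳ-mono E (↑ʳ-mono N le)))

  -- The z's form the last block, so whatever survives the elimination of `z e` is a later z.
  z-or-≤z : ∀ v e → enc v Fin.≤ enc (z e) ⊎ ∃ λ f → v ≡ z f × e Fin.≤ f
  z-or-≤z (w j) e = inj₁ (↑ˡ≤↑ʳ j _)
  z-or-≤z (r f) e = inj₁ (↑ʳ-mono N (↑ˡ≤↑ʳ f _))
  z-or-≤z (p f) e = inj₁ (↑ʳ-mono N (↑ʳ-mono E (↑ˡ≤↑ʳ f _)))
  z-or-≤z (u i) e = inj₁ (↑ʳ-mono N (↑ʳ-mono E (↑ʳ-mono E (↑ˡ≤↑ʳ i _))))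
  z-or-≤z (z f) e = Sum.map z≤z (λ e≤f → f , refl , e≤f) (≤-total (toℕ f) (toℕ e))

  data Name : Set where
    c b : Fin E → Name
    d   : Fin N → Name

  -- Each kind of clause has variables that occur in no other kind: the u's in `c`, the r's in `b`,
  -- the w's in `d`. Setting them to true switches a whole kind off, which isolates one step of the
  -- paths.
  data _∈ᶜ_ : Var → Name → Set where
    u∈c : ∀ {e i} → row e ≡ i → u i ∈ᶜ c e
    p∈c : ∀ {e} → p e ∈ᶜ c e
    z∈c : ∀ {e f} → e Fin.≤ f → z f ∈ᶜ c e
    r∈b : ∀ {e} → r e ∈ᶜ b e
    p∈b : ∀ {e} → p e ∈ᶜ b e
    z∈b : ∀ {e} → z e ∈ᶜ b e
    w∈d : ∀ {j} → w j ∈ᶜ d j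
    z∈d : ∀ {e j} → col e ≡ j → z e ∈ᶜ d j

  _∈ᶜ?_ : ∀ v K → Dec (v ∈ᶜ K)
  w j ∈ᶜ? c e = no λ ()
  r f ∈ᶜ? c e = no λ ()
  p f ∈ᶜ? c e = map′ (λ { refl → p∈c }) (λ { p∈c → refl }) (f Fin.≟ e)
  u i ∈ᶜ? c e = map′ u∈c (λ { (u∈c eq) → eq }) (row e Fin.≟ i)
  z f ∈ᶜ? c e = map′ z∈c (λ { (z∈c le) → le }) (e Fin.≤? f)
  w j ∈ᶜ? b e = no λ ()
  r f ∈ᶜ? b e = map′ (λ { refl → r∈b }) (λ { r∈b → refl }) (f Fin.≟ e)
  p f ∈ᶜ? b e = map′ (λ { refl → p∈b }) (λ { p∈b → refl }) (f Fin.≟ e)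
  u i ∈ᶜ? b e = no λ ()
  z f ∈ᶜ? b e = map′ (λ { refl → z∈b }) (λ { z∈b → refl }) (f Fin.≟ e)
  w i ∈ᶜ? d j = map′ (λ { refl → w∈d }) (λ { w∈d → refl }) (i Fin.≟ j)
  r f ∈ᶜ? d j = no λ ()
  p f ∈ᶜ? d j = no λ ()
  u i ∈ᶜ? d j = no λ ()
  z f ∈ᶜ? d j = map′ z∈d (λ { (z∈d eq) → eq }) (col f Fin.≟ j)

  clause : Name → Clause #vars
  clause K = map pos (filter (λ x → dec x ∈ᶜ? K) (allFin #vars))

  names : List Name
  names = map c (allFin E) ++ map b (allFin E) ++ map d (allFin N)

  ∈-names : ∀ K → K ∈ˡ names
  ∈-names (c e) = ∈-++⁺ˡ (∈-map⁺ c (∈-allFin e))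
  ∈-names (b e) = ∈-++⁺ʳ (map c (allFin E)) (∈-++⁺ˡ (∈-map⁺ b (∈-allFin e)))
  ∈-names (d j) = ∈-++⁺ʳ (map c (allFin E)) (∈-++⁺ʳ (map b (allFin E)) (∈-map⁺ d (∈-allFin j)))

  ∈-clause⁺ : ∀ {v K} → v ∈ᶜ K → pos (enc v) ∈ˡ clause K
  ∈-clause⁺ {v} {K} v∈K = ∈-map⁺ pos (∈-filter⁺ (λ x → dec x ∈ᶜ? K) (∈-allFin (enc v))
    (subst (_∈ᶜ K) (sym (dec-enc v)) v∈K))

  ∈-clause⁻ : ∀ {l} K → l ∈ˡ clause K → ∃ λ v → l ≡ pos (enc v) × v ∈ᶜ K
  ∈-clause⁻ K l∈ with ∈-map⁻ pos l∈
  ... | x , x∈ , refl = dec x , cong pos (sym (enc-dec x)) ,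
    proj₂ (∈-filter⁻ (λ x → dec x ∈ᶜ? K) {xs = allFin #vars} x∈)

  formula : CNF #vars
  formula = record
    { clauses         = map clause names
    ; nonTautological = All.map⁺ (All.universal positive names)
    ; covers          = λ x →
        subst (Sub._∈ ⋃ (map var (map clause names))) (enc-dec x) (covered (dec x))
    }
    where
    positive : ∀ K → ¬ Tautological (clause K)
    positive K (x , _ , neg∈) with ∈-clause⁻ K neg∈
    ... | _ , () , _

    occurs : ∀ {v K} → v ∈ᶜ K → enc v Sub.∈ ⋃ (map var (map clause names))
    occurs {K = K} v∈K = ∈-⋃⁺ (∈-map⁺ var (∈-map⁺ clause (∈-names K))) (∈-var⁺ (∈-clause⁺ v∈K))

    covered : ∀ v → enc v Sub.∈ ⋃ (map var (map clause names))
    covered (w j) = occurs w∈d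
    covered (r e) = occurs r∈b
    covered (p e) = occurs p∈b
    -- Any edge of row `i` would serve; the diagonal one always exists.
    covered (u i) = occurs (u∈c (row-edge i i))
    covered (z e) = occurs z∈b

  satisfies⁺ : ∀ {τ} → (∀ K → ∃ λ v → v ∈ᶜ K × τ (enc v) ≡ true) → evalCNF formula τ ≡ true
  satisfies⁺ {τ} sat = evalCNF⁺ formula clause-sat
    where
    clause-sat : ∀ {C} → C ∈ˡ map clause names → ∃ λ l → l ∈ˡ C × evalLiteral τ l ≡ true
    clause-sat C∈ with ∈-map⁻ clause C∈
    ... | K , _ , refl = let v , v∈K , eq = sat K in pos (enc v) , ∈-clause⁺ v∈K , eq

  satisfies⁻ : ∀ {τ} → evalCNF formula τ ≡ true → ∀ K → ∃ λ v → v ∈ᶜ K × τ (enc v) ≡ true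
  satisfies⁻ {τ} sat K with evalCNF⁻ formula sat (∈-map⁺ clause (∈-names K))
  ... | l , l∈ , eq with ∈-clause⁻ K l∈
  ...   | v , refl , v∈K = v , v∈K , eq

  -- β-acyclicity of the formula.

  _∖_⊆ᶜ_ : Name → Var → Name → Set
  K ∖ v ⊆ᶜ L = ∀ {a} → a ∈ᶜ K → ¬ enc a Fin.≤ enc v → a ∈ᶜ L

  -- `r e` is eliminated before `p e`, which leaves only `z e`, the first z of the tail in `c e`.
  b∖p⊆c : ∀ {e} → b e ∖ p e ⊆ᶜ c e
  b∖p⊆c r∈b ≰ = contradiction (r≤p _ _) ≰
  b∖p⊆c p∈b _ = p∈c
  b∖p⊆c z∈b _ = z∈c ≤-refl

  -- Once the p's are gone, clauses `c` of the same row differ only in their tails of z's, and tails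
  -- of a linear order are nested.
  c∖u⊆c : ∀ {e f i} → row f ≡ row e → f Fin.≤ e → c e ∖ u i ⊆ᶜ c f
  c∖u⊆c eq f≤e (u∈c refl) _ = u∈c eq
  c∖u⊆c eq f≤e p∈c        ≰ = contradiction (p≤u _ _) ≰
  c∖u⊆c eq f≤e (z∈c e≤g)  _ = z∈c (≤-trans f≤e e≤g)

  -- Only z's beyond `e` are left, in whatever clause, and `c f` contains all of them.
  ∖z⊆c : ∀ {K e f} → f Fin.≤ e → K ∖ z e ⊆ᶜ c f
  ∖z⊆c {e = e} f≤e {a} _ ≰ with z-or-≤z a e
  ... | inj₁ ≤z              = contradiction ≤z ≰
  ... | inj₂ (_ , refl , e≤) = z∈c (≤-trans f≤e e≤)

  b∖z⊆ : ∀ {e L} → b e ∖ z e ⊆ᶜ L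
  b∖z⊆ {e} {a = a} a∈b ≰ with z-or-≤z a e
  b∖z⊆ _   ≰ | inj₁ ≤z = contradiction ≤z ≰
  b∖z⊆ z∈b ≰ | inj₂ _  = contradiction ≤-refl ≰

  -- Each w and each r lies in one clause. A `z e` lies in clauses `c f` with `f ≤ e`, which absorb
  -- all that remains, in `b e`, of which nothing remains, and in the single `d` of its column.
  chain : ∀ {v K L} → v ∈ᶜ K → v ∈ᶜ L → K ∖ v ⊆ᶜ L ⊎ L ∖ v ⊆ᶜ K
  chain w∈d        w∈d        = inj₁ λ a∈ _ → a∈
  chain r∈b        r∈b        = inj₁ λ a∈ _ → a∈
  chain p∈c        p∈c        = inj₁ λ a∈ _ → a∈
  chain p∈c        p∈b        = inj₂ b∖p⊆c
  chain p∈b        p∈c        = inj₁ b∖p⊆c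
  chain p∈b        p∈b        = inj₁ λ a∈ _ → a∈
  chain (u∈c {e} refl) (u∈c {f} eq) =
    Sum.map (c∖u⊆c eq) (c∖u⊆c (sym eq)) (≤-total (toℕ f) (toℕ e))
  chain _          (z∈c f≤e)  = inj₁ (∖z⊆c f≤e)
  chain (z∈c f≤e)  _          = inj₂ (∖z⊆c f≤e)
  chain z∈b        _          = inj₁ b∖z⊆
  chain (z∈d _)    z∈b        = inj₂ b∖z⊆
  chain (z∈d refl) (z∈d refl) = inj₁ λ a∈ _ → a∈

  β-acyclic : βAcyclicCNF formula
  -- The numbering of the variables is itself the elimination order.
  β-acyclic = #vars , id , record
    { injective  = id
    ; enumerates = λ v → mk⇔ (λ _ → v , refl) (λ _ → CNF.covers formula v)
    ; nested     = nested
    }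
    where
    named : ∀ {e} → e ∈ˡ hypergraph formula → ∃ λ K → e ≡ var (clause K)
    named e∈ with ∈-map⁻ var e∈
    ... | _ , C∈ , refl with ∈-map⁻ clause C∈
    ...   | K , _ , refl = K , refl

    incident : ∀ K {x} → x Sub.∈ var (clause K) → ∃ λ v → x ≡ enc v × v ∈ᶜ K
    incident K x∈ with ∈-var⁻ {C = clause K} x∈
    ... | l , l∈ , refl with ∈-clause⁻ K l∈
    ...   | v , refl , v∈K = v , refl , v∈K

    restrict : ∀ {K L v} → K ∖ v ⊆ᶜ L → var (clause K) ∖⟨ id upTo enc v ⟩⊆ var (clause L)
    restrict {K} {L} K⊆L x∈ ≰ with incident K x∈
    ... | a , refl , a∈K = ∈-var⁺ (∈-clause⁺ {K = L} (K⊆L a∈K λ a≤v → ≰ (enc a , a≤v , refl)))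

    nested : ∀ i {e f} → e ∈ˡ hypergraph formula → f ∈ˡ hypergraph formula → i Sub.∈ e Sub.∩ f →
             (e ∖⟨ id upTo i ⟩⊆ f) ⊎ (f ∖⟨ id upTo i ⟩⊆ e)
    nested i e∈ f∈ i∈ with named e∈ | named f∈
    ... | K , refl | L , refl with x∈p∩q⁻ (var (clause K)) (var (clause L)) i∈
    ...   | i∈K , i∈L with incident K i∈K | incident L i∈L
    ...     | v , refl , v∈K | v′ , eq , v′∈L with enc-injective {v} {v′} eq
    ...       | refl = Sum.map (restrict {K} {L} {v}) (restrict {L} {K} {v}) (chain v∈K v′∈L)

-- Fooling sets

-- Values symbolic in `m` free bits, so that one table describes all 2^m assignments of a fooling
-- set.
data Value (m : ℕ) : Set where
  const   : Bool → Value m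
  bit bit̅ : Fin m → Value m

value : (Fin m → Bool) → Value m → Bool
value β (const x) = x
value β (bit k)   = β k
value β (bit̅ k)   = not (β k)

byIndex : (Fin m → Fin q) → (Fin m → Value m) → Bool → Fin q → Value m
byIndex f v x i with Fin.any? (λ k → f k Fin.≟ i)
... | yes (k , _) = v k
... | no _        = const x

module _ (f : Fin m → Fin q) (v : Fin m → Value m) (x : Bool) where

  byIndex-cases : ∀ i → (∃ λ k → f k ≡ i) ⊎ byIndex f v x i ≡ const x
  byIndex-cases i with Fin.any? (λ k → f k Fin.≟ i)
  ... | yes hit = inj₁ hit
  ... | no _    = inj₂ refl

  byIndex-hit : Injective _≡_ _≡_ f → ∀ k → byIndex f v x (f k) ≡ v k
  byIndex-hit f-inj k with Fin.any? (λ l → f l Fin.≟ f k)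
  ... | yes (l , eq) = cong v (f-inj eq)
  ... | no miss      = contradiction (k , refl) miss

bits : ∀ m → Fin (2 ^ m) → Fin m → Bool
bits m i = Inverse.to Fin.2↔Bool ∘ finToFun {2} {m} i

funToFin-cong : ∀ {m n} {f g : Fin m → Fin n} → (∀ k → f k ≡ g k) → funToFin f ≡ funToFin g
funToFin-cong {zero}  eq = refl
funToFin-cong {suc m} eq = cong₂ combine (eq zero) (funToFin-cong (eq ∘ suc))

bits-injective : ∀ m {i j} → (∀ k → bits m i k ≡ bits m j k) → i ≡ j
bits-injective m {i} {j} eq = begin
  i                              ≡⟨ sym (Fin.funToFin-finToFin {m} {2} i) ⟩
  funToFin (finToFun {2} {m} i)  ≡⟨ funToFin-cong (λ k → Injection.injective (↔⇒↣ Fin.2↔Bool) (eq k)) ⟩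
  funToFin (finToFun {2} {m} j)  ≡⟨ Fin.funToFin-finToFin {m} {2} j ⟩
  j                              ∎
  where open ≡-Reasoning

-- For `s ≢ t` the two premises are, in some order, `b ∨ ¬ c` and `c ∨ ¬ b`: two implications that
-- make an equivalence.
mix-agree : ∀ s t b c → s ≢ t →
  (if s then b else c) ≡ true ⊎ (if t then not b else not c) ≡ true →
  (if s then c else b) ≡ true ⊎ (if t then not c else not b) ≡ true → b ≡ c
mix-agree _     _     true  true  _   _ _ = refl
mix-agree _     _     false false _   _ _ = refl
mix-agree true  true  _     _     s≢t _ _ = contradiction refl s≢t
mix-agree false false _     _     s≢t _ _ = contradiction refl s≢t
mix-agree true  false true  false _ _ (inj₁ ())
mix-agree true  false true  false _ _ (inj₂ ())
mix-agree true  false false true  _ (inj₁ ()) _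
mix-agree true  false false true  _ (inj₂ ()) _
mix-agree false true  true  false _ (inj₁ ()) _
mix-agree false true  true  false _ (inj₂ ()) _
mix-agree false true  false true  _ _ (inj₁ ())
mix-agree false true  false true  _ _ (inj₂ ())

triple : ℕ → ℕ
triple m = m + m + m

m≤triple : ∀ m → m ≤ triple m
m≤triple m = m≤n+m m (m + m)

module LowerBound (N : ℕ) where
  open Formula N

  -- The restriction to ⋀ₖ (xₖ ∨ yₖ): `only` shrinks the clause `K k` to its k-th conjunct, and
  -- `satisfied` ensures that no clause demands more than these conjuncts.
  record FoolingSet (A : Fin #vars → Bool) (m : ℕ) : Set where
    field
      val       : Var → Value m
      x y       : Fin m → Var
      K         : Fin m → Name
      val-x     : ∀ k → val (x k) ≡ bit k
      val-y     : ∀ k → val (y k) ≡ bit̅ k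
      separated : ∀ k → A (enc (x k)) ≢ A (enc (y k))
      only      : ∀ k {a} → a ∈ᶜ K k → val a ≡ const false ⊎ a ≡ x k ⊎ a ≡ y k
      satisfied : ∀ L → (∃ λ a → a ∈ᶜ L × val a ≡ const true) ⊎ (∃ λ k → x k ∈ᶜ L × y k ∈ᶜ L)

    assignment : (Fin m → Bool) → Assignment #vars
    assignment β a = value β (val (dec a))

    assignment-enc : ∀ β a → assignment β (enc a) ≡ value β (val a)
    assignment-enc β a = cong (value β ∘ val) (dec-enc a)

    assignment-sat : ∀ β → evalCNF formula (assignment β) ≡ true
    assignment-sat β = satisfies⁺ sat
      where
      sat : ∀ L → ∃ λ v → v ∈ᶜ L × assignment β (enc v) ≡ true
      sat L with satisfied L
      ... | inj₁ (a , a∈ , eq) = a , a∈ , trans (assignment-enc β a) (cong (value β) eq)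
      ... | inj₂ (k , x∈ , y∈) with β k in eq
      ...   | true  = x k , x∈ , trans (assignment-enc β (x k)) (trans (cong (value β) (val-x k)) eq)
      ...   | false = y k , y∈ ,
        trans (assignment-enc β (y k)) (trans (cong (value β) (val-y k)) (cong not eq))

    -- Variables that are constantly false stay false in a mixture, so a true variable of `K k` has
    -- to be `x k` or `y k`.
    mixed : ∀ {β γ} → evalCNF formula (mix A (assignment β) (assignment γ)) ≡ true → ∀ k →
            (if A (enc (x k)) then β k else γ k) ≡ true ⊎
            (if A (enc (y k)) then not (β k) else not (γ k)) ≡ true
    mixed {β} {γ} sat k with satisfies⁻ sat (K k)
    ... | a , a∈K , a-true with only k a∈K
    ...   | inj₁ eq = contradiction (trans (sym a-true) a-false) λ ()
      where
      a-false : mix A (assignment β) (assignment γ) (enc a) ≡ false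
      a-false rewrite assignment-enc β a | assignment-enc γ a | eq = if-eta (A (enc a))
    ...   | inj₂ (inj₁ refl) rewrite assignment-enc β a | assignment-enc γ a | val-x k = inj₁ a-true
    ...   | inj₂ (inj₂ refl) rewrite assignment-enc β a | assignment-enc γ a | val-y k = inj₂ a-true

    -- Bit vectors map to the separators of their assignments. If two share a gate, both mixtures
    -- satisfy the formula, and then the vectors agree in every bit.
    size-bound : (D : NNF #vars) → D Computes formula → ∀ {T} → Respects D T → Laminar A T →
                 2 ^ m ≤ NNF.size D
    size-bound D D≡F R lam = Fin.injective⇒≤ {f = gate} gate-injective
      where
      τ : Fin (2 ^ m) → Assignment #vars
      τ i = assignment (bits m i)

      sep : ∀ i → Separator A (NNF.gates D) (τ i) (NNF.output D)
      sep i = separator A lam (NNF.gates D) R (NNF.output D)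
        (lookup⇒[]= (NNF.output D) _ (trans (D≡F (τ i)) (assignment-sat (bits m i))))

      gate : Fin (2 ^ m) → Fin (NNF.size D)
      gate i = proj₁ (sep i)

      mix-sat : ∀ i j → gate i ≡ gate j → evalCNF formula (mix A (τ i) (τ j)) ≡ true
      mix-sat i j eq = trans (sym (D≡F _)) ([]=⇒lookup (proj₂ (proj₂ (sep j)) (τ i)
        (subst (Sub._∈ trueGates (NNF.gates D) (τ i)) eq (proj₁ (proj₂ (sep i))))))

      gate-injective : Injective _≡_ _≡_ gate
      gate-injective {i} {j} eq = bits-injective m λ k → mix-agree _ _ _ _ (separated k)
        (mixed (mix-sat i j eq) k) (mixed (mix-sat j i (sym eq)) k)

  -- Fooling sets for each of the three steps of a path.

  module _ {A : Fin #vars → Bool} (e : Fin m → Fin E) where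

    -- False z's shrink `c (e k)` to u ∨ p. The u's depend only on the row, so rows must be
    -- distinct; the default true of the p's satisfies every other `c`.
    fool-up : Injective _≡_ _≡_ (row ∘ e) → (∀ k → A (enc (u (row (e k)))) ≢ A (enc (p (e k)))) →
              FoolingSet A m
    fool-up row-inj sep = record
      { val       = val
      ; x         = u ∘ row ∘ e
      ; y         = p ∘ e
      ; K         = c ∘ e
      ; val-x     = byIndex-hit (row ∘ e) bit true row-inj
      ; val-y     = byIndex-hit e bit̅ true (row-inj ∘ cong row)
      ; separated = sep
      ; only      = λ where
          k (u∈c refl) → inj₂ (inj₁ refl)
          k p∈c        → inj₂ (inj₂ refl)
          k (z∈c _)    → inj₁ refl
      ; satisfied = satisfied
      }
      where
      val : Var → Value m
      val (u i) = byIndex (row ∘ e) bit true i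
      val (p f) = byIndex e bit̅ true f
      val (z _) = const false
      val (r _) = const true
      val (w _) = const true

      satisfied : ∀ L → (∃ λ a → a ∈ᶜ L × val a ≡ const true) ⊎
                        (∃ λ k → u (row (e k)) ∈ᶜ L × p (e k) ∈ᶜ L)
      satisfied (b f) = inj₁ (r f , r∈b , refl)
      satisfied (d j) = inj₁ (w j , w∈d , refl)
      satisfied (c f) with byIndex-cases e bit̅ true f
      ... | inj₁ (k , refl) = inj₂ (k , u∈c refl , p∈c)
      ... | inj₂ eq         = inj₁ (p f , p∈c , eq)

    -- False r's shrink `b (e k)` to p ∨ z; every other `b` is satisfied by its p.
    fool-pz : Injective _≡_ _≡_ e → (∀ k → A (enc (p (e k))) ≢ A (enc (z (e k)))) → FoolingSet A m
    fool-pz e-inj sep = record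
      { val       = val
      ; x         = p ∘ e
      ; y         = z ∘ e
      ; K         = b ∘ e
      ; val-x     = byIndex-hit e bit true e-inj
      ; val-y     = byIndex-hit e bit̅ false e-inj
      ; separated = sep
      ; only      = λ where
          k r∈b → inj₁ refl
          k p∈b → inj₂ (inj₁ refl)
          k z∈b → inj₂ (inj₂ refl)
      ; satisfied = satisfied
      }
      where
      val : Var → Value m
      val (u _) = const true
      val (p f) = byIndex e bit true f
      val (z f) = byIndex e bit̅ false f
      val (r _) = const false
      val (w _) = const true

      satisfied : ∀ L → (∃ λ a → a ∈ᶜ L × val a ≡ const true) ⊎
                        (∃ λ k → p (e k) ∈ᶜ L × z (e k) ∈ᶜ L)
      satisfied (c f) = inj₁ (u (row f) , u∈c refl , refl)
      satisfied (d j) = inj₁ (w j , w∈d , refl)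
      satisfied (b f) with byIndex-cases e bit true f
      ... | inj₁ (k , refl) = inj₂ (k , p∈b , z∈b)
      ... | inj₂ eq         = inj₁ (p f , p∈b , eq)

    -- A clause `d` contains all z's of its column. The default false removes the unselected ones,
    -- and distinct columns leave just one selected z in it.
    fool-zw : Injective _≡_ _≡_ (col ∘ e) → (∀ k → A (enc (z (e k))) ≢ A (enc (w (col (e k))))) →
              FoolingSet A m
    fool-zw col-inj sep = record
      { val       = val
      ; x         = z ∘ e
      ; y         = w ∘ col ∘ e
      ; K         = d ∘ col ∘ e
      ; val-x     = byIndex-hit e bit false (col-inj ∘ cong col)
      ; val-y     = byIndex-hit (col ∘ e) bit̅ true col-inj
      ; separated = sep
      ; only      = only
      ; satisfied = satisfied
      }
      where
      val : Var → Value m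
      val (u _) = const true
      val (p _) = const true
      val (z f) = byIndex e bit false f
      val (r _) = const true
      val (w j) = byIndex (col ∘ e) bit̅ true j

      only : ∀ k {a} → a ∈ᶜ d (col (e k)) →
             val a ≡ const false ⊎ a ≡ z (e k) ⊎ a ≡ w (col (e k))
      only k w∈d = inj₂ (inj₂ refl)
      only k (z∈d {f} eq) with byIndex-cases e bit false f
      ... | inj₁ (l , refl) = inj₂ (inj₁ (cong (z ∘ e) (col-inj eq)))
      ... | inj₂ f-false    = inj₁ f-false

      satisfied : ∀ L → (∃ λ a → a ∈ᶜ L × val a ≡ const true) ⊎
                        (∃ λ k → z (e k) ∈ᶜ L × w (col (e k)) ∈ᶜ L)
      satisfied (c f) = inj₁ (u (row f) , u∈c refl , refl)
      satisfied (b f) = inj₁ (r f , r∈b , refl)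
      satisfied (d j) with byIndex-cases (col ∘ e) bit̅ true j
      ... | inj₁ (k , refl) = inj₂ (k , z∈d refl , w∈d)
      ... | inj₂ eq         = inj₁ (w j , w∈d , eq)

  -- Matchings across a cut, and the bound for structured circuits.

  CutMatching : (Fin #vars → Bool) → ℕ → Set
  CutMatching A s = ∃ λ (e : Fin s → Fin E) →
    Injective _≡_ _≡_ (row ∘ e) × Injective _≡_ _≡_ (col ∘ e) ×
    (∀ k → A (enc (u (row (e k)))) ≢ A (enc (w (col (e k)))))

  -- A cut of an edge separates two neighbours on the path u – p – z – w.
  fooling : ∀ m (A : Fin #vars → Bool) → CutMatching A (triple m) → FoolingSet A m
  fooling m A (e , row-inj , col-inj , u≢w)
    -- Of the 3m edges, m are cut between u and p, or 2m are not; of these, m are cut between p and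
    -- z, or m are not and must be cut between z and w.
    with split (m + m) m (λ k → A (enc (u (row (e k)))) Bool.≟ A (enc (p (e k)))) ≤-refl
  ... | inj₂ (f , f-inj , u≢p) = fool-up (e ∘ f) (f-inj ∘ row-inj) u≢p
  ... | inj₁ (f , f-inj , u≡p)
    with split m m (λ k → A (enc (p (e (f k)))) Bool.≟ A (enc (z (e (f k))))) ≤-refl
  ...   | inj₂ (g , g-inj , p≢z) = fool-pz (e ∘ f ∘ g) (g-inj ∘ f-inj ∘ row-inj ∘ cong row) p≢z
  ...   | inj₁ (g , g-inj , p≡z) = fool-zw (e ∘ f ∘ g) (g-inj ∘ f-inj ∘ col-inj) λ k z≡w →
          u≢w (f (g k)) (trans (u≡p (g k)) (trans (p≡z k) z≡w))

  matched : ∀ {s} (A : Fin #vars → Bool) {f h : Fin s → Fin N} →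
    Injective _≡_ _≡_ f → Injective _≡_ _≡_ h → (∀ k → A (enc (u (f k))) ≢ A (enc (w (h k)))) →
    CutMatching A s
  matched A {f} {h} f-inj h-inj f≢h =
      (λ k → edge (f k) (h k))
    , (λ eq → f-inj (trans (sym (row-edge _ _)) (trans eq (row-edge _ _))))
    , (λ eq → h-inj (trans (sym (col-edge _ _)) (trans eq (col-edge _ _))))
    , λ k eq → f≢h k (subst₂ (λ i j → A (enc (u i)) ≡ A (enc (w j))) (row-edge _ _) (col-edge _ _) eq)

  -- One side of the cut holds at least `s` of the w's. They are paired with u's from the opposite
  -- side, as every pair is an edge.
  matching : ∀ s (A : Fin #vars → Bool) → s + s ≤ N →
    Selection s (λ i → A (enc (u i)) ≡ true) → Selection s (λ i → A (enc (u i)) ≡ false) →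
    CutMatching A s
  matching s A 2s≤N (f , f-inj , f-in) (g , g-inj , g-out)
    with split s s (λ j → A (enc (w j)) Bool.≟ true) 2s≤N
  ... | inj₁ (h , h-inj , h-in)  = matched A g-inj h-inj λ k eq →
    contradiction (trans (sym (g-out k)) (trans eq (h-in k))) λ ()
  ... | inj₂ (h , h-inj , h-out) = matched A f-inj h-inj λ k eq →
    h-out k (trans (sym eq) (f-in k))

  enc-u : Fin N → Fin #vars
  enc-u i = enc (u i)

  enc-u-injective : Injective _≡_ _≡_ enc-u
  enc-u-injective {i} {j} eq with enc-injective {u i} {u j} eq
  ... | refl = refl

  structured-bound : ∀ m → 1 ≤ m → triple (triple m) ≤ N →
    (D : NNF #vars) → Structured D → D Computes formula → 2 ^ m ≤ NNF.size D
  structured-bound m 1≤m 9m≤N D (T , (T-unique , T-full) , R) D≡F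
    with balanced enc-u enc-u-injective (≤-trans 1≤m (m≤triple m)) T s≤marked
    where
    s≤marked : triple m ≤ ∣ marked enc-u T ∣
    s≤marked = begin
      triple m            ≤⟨ m≤triple (triple m) ⟩
      triple (triple m)   ≤⟨ 9m≤N ⟩
      N                   ≡⟨ sym (∣⊤∣≡n N) ⟩
      ∣ ⊤ {N} ∣           ≤⟨ p⊆q⇒∣p∣≤∣q∣ {p = ⊤ {N}} (λ {i} _ → marked⁺ enc-u T (T-full (enc-u i))) ⟩
      ∣ marked enc-u T ∣  ∎
      where open ≤-Reasoning
  ... | t , t∈T , s≤t , t≤2s =
    FoolingSet.size-bound
      (fooling m (below t) (matching (triple m) (below t) 6m≤N u-below u-above))
      D D≡F R (laminar-below T-unique t∈T)
    where
    6m≤N : triple m + triple m ≤ N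
    6m≤N = ≤-trans (m≤m+n (triple m + triple m) (triple m)) 9m≤N

    u-below : Selection (triple m) (λ i → below t (enc-u i) ≡ true)
    u-below with select _ (marked enc-u t) s≤t
    ... | f , f-inj , f∈ = f , f-inj , ∈-tabulate⁻ ∘ f∈

    u-above : Selection (triple m) (λ i → below t (enc-u i) ≡ false)
    -- At most 6m of the at least 9m u's lie below `t`.
    u-above = select-false _ _ (≤-trans (+-monoˡ-≤ (triple m) t≤2s) 9m≤N)

-- The family, and the bound in terms of the number of variables.

width : ℕ → ℕ
width m = triple (triple m)

family : ∀ m → CNF (Formula.#vars (width m))
family m = Formula.formula (width m)

data Family : ∀ {n} → CNF n → Set where
  member : ∀ m → Family (family (suc m))

m≤#vars : ∀ m → m ≤ Formula.#vars (width m)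
m≤#vars m = ≤-trans (m≤triple m) (≤-trans (m≤triple (triple m)) (m≤m+n (width m) _))

-- With N = 9m there are 3N² + 2N variables. The coefficient 261 is rounded up to 289 = 17² to give
-- a rational constant 1/17.
#vars≤ : ∀ m → 1 ≤ m → Formula.#vars (width m) ≤ 289 * (m * m)
#vars≤ m 1≤m = begin
  Formula.#vars (width m)     ≡⟨ solve 1 (λ m → let N = tri (tri m) ; E = N :* N in
                                 N :+ (E :+ (E :+ (N :+ E))) := con 243 :* (m :* m) :+ con 18 :* m) refl m ⟩
  243 * (m * m) + 18 * m
    ≤⟨ +-monoʳ-≤ (243 * (m * m)) (*-monoʳ-≤ 18 (m≤m*n m m {{>-nonZero 1≤m}})) ⟩
  243 * (m * m) + 18 * (m * m)  ≡⟨ sym (*-distribʳ-+ (m * m) 243 18) ⟩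
  261 * (m * m)               ≤⟨ *-monoˡ-≤ (m * m) (m≤m+n 261 28) ⟩
  289 * (m * m)               ∎
  where
  open ≤-Reasoning
  open +-*-Solver

  tri : ∀ {k} → Polynomial k → Polynomial k
  tri m = m :+ m :+ m

square-cancel : ∀ {a b} → a * a ≤ b * b → a ≤ b
square-cancel {a} {b} le with a ≤? b
... | yes a≤b = a≤b
... | no a≰b = contradiction le (<⇒≱ (*-mono-< (≰⇒> a≰b) (≰⇒> a≰b)))

1/17 : ℚᵘ
1/17 = + 1 ℚᵘ./ 17

-- From (a/b)² ≤ n/289 ≤ m² follows a ≤ mb, whence 2^a ≤ (2^m)^b.
root-bound : ∀ {n m S} → n ≤ 289 * (m * m) → 2 ^ m ≤ S → 2^⟨ 1/17 √ n ⟩≤ S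
root-bound n≤ 2^m≤S a zero {{b≢0}} _ = contradiction refl (≢-nonZero⁻¹ 0 {{b≢0}})
root-bound {n} {m} {S} n≤ 2^m≤S a b@(suc _) (*≤* le) = begin
  2 ^ a         ≤⟨ ^-monoʳ-≤ 2 a≤mb ⟩
  2 ^ (m * b)   ≡⟨ sym (^-*-assoc 2 m b) ⟩
  (2 ^ m) ^ b   ≤⟨ ^-monoˡ-≤ b 2^m≤S ⟩
  S ^ b         ∎
  where
  open ≤-Reasoning

  -- The inequality of fractions cross-multiplied; 289 is the denominator of the right-hand side.
  ℕ-le : a * a * 289 ≤ n * (b * b)
  ℕ-le = ℤ.drop‿+≤+ (subst₂ ℤ._≤_
    (trans (cong (ℤ._* + 289) (sym (ℤ.pos-* a a))) (sym (ℤ.pos-* (a * a) 289)))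
    (trans (cong (ℤ._* + (b * b)) (ℤ.*-identityˡ (+ n))) (sym (ℤ.pos-* n (b * b)))) le)

  a≤mb : a ≤ m * b
  a≤mb = square-cancel (*-cancelʳ-≤ (a * a) (m * b * (m * b)) 289 (begin
    a * a * 289              ≤⟨ ℕ-le ⟩
    n * (b * b)              ≤⟨ *-monoˡ-≤ (b * b) n≤ ⟩
    289 * (m * m) * (b * b)  ≡⟨ solve 2 (λ m b → con 289 :* (m :* m) :* (b :* b) :=
                                  m :* b :* (m :* b) :* con 289) refl m b ⟩
    m * b * (m * b) * 289    ∎))
    where open +-*-Solver

theorem9 : Σ[ 𝓕 ∈ (∀ {n} → Pred (CNF n) 0ℓ) ]
    (∀ N → ∃[ n ] (N ≤ n × Σ[ F ∈ CNF n ] 𝓕 F))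
    × (∀ {n} (F : CNF n) → F ∈ 𝓕 → βAcyclicCNF F)
    × Σ[ c ∈ ℚᵘ ] (Positive c × ∃[ n₀ ]
    (∀ {n} (F : CNF n) → F ∈ 𝓕 → n₀ ≤ n →
    (D : NNF n) → IsDNNF D → Structured D → D Computes F →
    2^⟨ c √ n ⟩≤ NNF.size D))
theorem9 = Family , infinite , acyclic , 1/17 , _ , 0 , bound
  where
  infinite : ∀ N → ∃[ n ] (N ≤ n × Σ[ F ∈ CNF n ] Family F)
  infinite N = _ , ≤-trans (n≤1+n N) (m≤#vars (suc N)) , family (suc N) , member N

  acyclic : ∀ {n} (F : CNF n) → Family F → βAcyclicCNF F
  acyclic _ (member m) = Formula.β-acyclic (width (suc m))

  bound : ∀ {n} (F : CNF n) → Family F → 0 ≤ n → (D : NNF n) → IsDNNF D → Structured D →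
          D Computes F → 2^⟨ 1/17 √ n ⟩≤ NNF.size D
  bound _ (member m) _ D _ D-str D≡F = root-bound {m = suc m} (#vars≤ (suc m) (s≤s z≤n))
    (LowerBound.structured-bound (width (suc m)) (suc m) (s≤s z≤n) ≤-refl D D-str D≡F)
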